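{- Let $t\neq 0$. For every integer $n\ge 0$, $$1+ \sum_{k=1}^n \frac{(-1)^k}{t^k} \left(L_{k+2} +(t-1)L_{k}\right) = \frac{(-1)^n}{t^n}L_{n+1},$$ where $L_k$ are the Lucas numbers.
   Context: The Lucas numbers $L_k$ ($k\ge 0$) satisfy $L_{n+2}=L_{n+1}+L_n$ for $n\ge 0$, with $L_0=2$, $L_1=1$. Here $t$ is an indeterminate, which may be specialized to any nonzero complex number. Empty sums equal $0$. -}

module Defs where

open import Algebra.Bundles using (CommutativeRing; Semiring)
open import Data.Fin.Base using (toℕ)
open import Data.Nat.Base as ℕ using (ℕ; zero; suc)
import Algebra.Definitions.RawSemiring as RawSemiringDefs

lucas : ℕ → ℕ
lucas zero          = 2
lucas (suc zero)    = 1
lucas (suc (suc n)) = lucas (suc n) ℕ.+ lucas n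

module InRing {c ℓ} (R : CommutativeRing c ℓ) where

  open CommutativeRing R using (Carrier; 1#; semiring)
  open Semiring semiring using (rawSemiring)
  open RawSemiringDefs rawSemiring public using (_^_)
  open RawSemiringDefs rawSemiring using (_×_; sum)

  -- The Lucas number as an element of R, via the canonical map ℕ → R.
  L : ℕ → Carrier
  L k = lucas k × 1#

  -- Σ₁ n f = f 1 + … + f n; the index i : Fin n stands for k = i + 1.
  Σ₁ : ℕ → (ℕ → Carrier) → Carrier
  Σ₁ n f = sum {n} (λ i → f (suc (toℕ i)))

{-# OPTIONS --safe #-}
module Submission where

-- The sum telescopes.  With aₖ = (-1)ᵏ t⁻ᵏ one has aₖ = - aₖ₊₁ t, and
-- Lₖ₊₃ + (t - 1) Lₖ₊₁ = Lₖ₊₂ + t Lₖ₊₁, so the (k+1)-st summand is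
-- aₖ₊₁ Lₖ₊₂ - aₖ Lₖ₊₁.

open import Defs
open import Algebra.Bundles using (CommutativeRing)
open import Data.Nat.Base as ℕ using (ℕ; zero; suc)
import Data.Nat.Properties as ℕ
import Algebra.Properties.CommutativeSemigroup as CommutativeSemigroupProperties
import Algebra.Properties.Monoid.Mult as MonoidMult
import Algebra.Properties.Ring as RingProperties
import Relation.Binary.Reasoning.Setoid as SetoidReasoning

-- The right-hand side, `partial n`, is a discrete antiderivative of the summand, and the leading 1
-- is its value at 0 because L₁ = 1. So the identity reduces to one difference computation,
-- `summand-suc`, and `telescope` sums it up. That computation combines the Lucas recurrence, which
-- turns the coefficient t - 1 into t, with the cancellation of this t against one factor t⁻¹. A
-- given inverse of t is the only division involved, so the argument runs in any commutative ring.

module _ {c ℓ} (R : CommutativeRing c ℓ) where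
  open CommutativeRing R hiding (zero)
  open InRing R
  open RingProperties ring using (-1*x≈-x; -‿distribˡ-*; //-rightDividesˡ)
  open CommutativeSemigroupProperties *-commutativeSemigroup using (interchange)
  open MonoidMult +-monoid using (×-homo-+)
  open SetoidReasoning setoid

  -- Induction on n with F and f left general: `Σ₁` splits off its first term, so the induction
  -- hypothesis is applied to both functions shifted by one.
  telescope : (F f : ℕ → Carrier) → (∀ k → F k + f (suc k) ≈ F (suc k)) →
              ∀ n → F 0 + Σ₁ n f ≈ F n
  telescope F f step zero    = +-identityʳ (F 0)
  telescope F f step (suc n) = begin
    F 0 + (f 1 + Σ₁ n (λ k → f (suc k)))  ≈⟨ +-assoc _ _ _ ⟨
    (F 0 + f 1) + Σ₁ n (λ k → f (suc k))  ≈⟨ +-congʳ (step 0) ⟩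
    F 1 + Σ₁ n (λ k → f (suc k))
      ≈⟨ telescope (λ k → F (suc k)) (λ k → f (suc k)) (λ k → step (suc k)) n ⟩
    F (suc n)                             ∎

  L-rec : ∀ k → L (suc (suc k)) ≈ L (suc k) + L k
  L-rec k = ×-homo-+ 1# (lucas (suc k)) (lucas k)

  -- Used with x = Lₖ₊₁: the copy released by expanding Lₖ₊₃ is absorbed into the (t - 1)-multiple.
  x+[t-1]x≈tx : ∀ t x → x + (t - 1#) * x ≈ t * x
  x+[t-1]x≈tx t x = begin
    x + (t - 1#) * x       ≈⟨ +-congʳ (*-identityˡ x) ⟨
    1# * x + (t - 1#) * x  ≈⟨ distribʳ x 1# (t - 1#) ⟨
    (1# + (t - 1#)) * x    ≈⟨ *-congʳ (+-comm 1# (t - 1#)) ⟩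
    ((t - 1#) + 1#) * x    ≈⟨ *-congʳ (//-rightDividesˡ 1# t) ⟩
    t * x                  ∎

  module _ {t t⁻¹ : Carrier} (t*t⁻¹≈1 : t * t⁻¹ ≈ 1#) where

    coeff : ℕ → Carrier
    coeff k = (- 1#) ^ k * t⁻¹ ^ k

    -- Passing from k to k + 1 multiplies the coefficient by -t⁻¹; the extra t cancels the inverse
    -- and leaves only the sign.
    coeff-suc*t : ∀ k → coeff (suc k) * t ≈ - coeff k
    coeff-suc*t k = begin
      coeff (suc k) * t               ≈⟨ *-congʳ (interchange (- 1#) _ t⁻¹ _) ⟩
      ((- 1# * t⁻¹) * coeff k) * t    ≈⟨ *-comm _ t ⟩
      t * ((- 1# * t⁻¹) * coeff k)    ≈⟨ *-congˡ (*-congʳ (*-comm (- 1#) t⁻¹)) ⟩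
      t * ((t⁻¹ * - 1#) * coeff k)    ≈⟨ *-congˡ (*-assoc t⁻¹ (- 1#) (coeff k)) ⟩
      t * (t⁻¹ * (- 1# * coeff k))    ≈⟨ *-assoc t t⁻¹ _ ⟨
      (t * t⁻¹) * (- 1# * coeff k)    ≈⟨ *-congʳ t*t⁻¹≈1 ⟩
      1# * (- 1# * coeff k)           ≈⟨ *-identityˡ _ ⟩
      - 1# * coeff k                  ≈⟨ -1*x≈-x (coeff k) ⟩
      - coeff k                       ∎

    summand : ℕ → Carrier
    summand k = coeff k * (L (k ℕ.+ 2) + (t - 1#) * L k)

    partial : ℕ → Carrier
    partial k = coeff k * L (k ℕ.+ 1)

    summand-suc : ∀ k → summand (suc k) ≈ partial (suc k) - partial k
    -- Addition recurses on its left argument, so `k ℕ.+ 2` and `k ℕ.+ 1` are flipped to let `lucas`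
    -- unfold.
    summand-suc k rewrite ℕ.+-comm k 2 | ℕ.+-comm k 1 = begin
      b * (L (3 ℕ.+ k) + (t - 1#) * x)  ≈⟨ *-congˡ (+-congʳ (L-rec (suc k))) ⟩
      b * ((y + x) + (t - 1#) * x)      ≈⟨ *-congˡ (+-assoc y x _) ⟩
      b * (y + (x + (t - 1#) * x))      ≈⟨ *-congˡ (+-congˡ (x+[t-1]x≈tx t x)) ⟩
      b * (y + t * x)                   ≈⟨ distribˡ b y (t * x) ⟩
      b * y + b * (t * x)               ≈⟨ +-congˡ (*-assoc b t x) ⟨
      b * y + (b * t) * x               ≈⟨ +-congˡ (*-congʳ (coeff-suc*t k)) ⟩
      b * y + - coeff k * x             ≈⟨ +-congˡ (-‿distribˡ-* (coeff k) x) ⟨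
      b * y - coeff k * x               ∎
      where
      b = coeff (suc k)
      x = L (suc k)
      y = L (suc (suc k))

    partial-step : ∀ k → partial k + summand (suc k) ≈ partial (suc k)
    partial-step k = begin
      partial k + summand (suc k)                ≈⟨ +-congˡ (summand-suc k) ⟩
      partial k + (partial (suc k) - partial k)  ≈⟨ +-comm _ _ ⟩
      (partial (suc k) - partial k) + partial k  ≈⟨ //-rightDividesˡ (partial k) (partial (suc k)) ⟩
      partial (suc k)                            ∎

    partial-zero : partial 0 ≈ 1#
    partial-zero = begin
      -- Both zeroth powers compute to `1#`, and `L 1`, being `1 × 1#`, computes to `1# + 0#`.
      (1# * 1#) * (1# + 0#)  ≈⟨ *-cong (*-identityˡ 1#) (+-identityʳ 1#) ⟩
      1# * 1#                ≈⟨ *-identityˡ 1# ⟩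
      1#                     ∎

mainTheorem7 : ∀ {c ℓ} (R : CommutativeRing c ℓ) →
    let open CommutativeRing R
        open InRing R
    in (t t⁻¹ : Carrier) → t * t⁻¹ ≈ 1# → (n : ℕ) →
       1# + Σ₁ n (λ k → ((- 1#) ^ k * t⁻¹ ^ k) * (L (k ℕ.+ 2) + (t - 1#) * L k))
         ≈ ((- 1#) ^ n * t⁻¹ ^ n) * L (n ℕ.+ 1)
mainTheorem7 R t t⁻¹ t*t⁻¹≈1 n =
  trans (+-congʳ (sym (partial-zero R t*t⁻¹≈1)))
        (telescope R (partial R t*t⁻¹≈1) (summand R t*t⁻¹≈1) (partial-step R t*t⁻¹≈1) n)
  where open CommutativeRing R
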